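{- For every integer $d>2$, the logic ${\cal R}ing(0,+,*)$ is strictly less expressive than ${\cal R}ing(0,+,*)+MOD(d)$: every sentence of ${\cal R}ing(0,+,*)$ is a sentence of ${\cal R}ing(0,+,*)+MOD(d)$, and there is a sentence $\theta$ of ${\cal R}ing(0,+,*)+MOD(d)$ such that no sentence $\sigma$ of ${\cal R}ing(0,+,*)$ satisfies $\mathbb{Z}_m\models\sigma \iff \mathbb{Z}_m\models\theta$ for all integers $m\ge1$.
   Context: For an integer $m\ge 1$, $\mathbb{Z}_m$ is the finite residue class ring with universe $\{0,\ldots,m-1\}$ and addition and multiplication mod $m$. ${\cal R}ing(0,+,*)$ is the set of first-order formulas over a constant symbol $0$ and binary function symbols $+,*$, interpreted in $\mathbb{Z}_m$ as the residue class $0$ and addition and multiplication mod $m$. ${\cal R}ing(0,+,*)+MOD(d)$ is its extension closed additionally under the modular quantifiers $\exists^{(r,d)}z$ for $0\le r<d$, where $\mathbb{Z}_m\models\exists^{(r,d)}z\,\phi(\bar a,z)$ iff the number of $z\in\mathbb{Z}_m$ satisfying $\phi(\bar a,z)$ is congruent to $r$ modulo $d$. -}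

module Defs where

open import Data.Nat using (ℕ; zero; suc; _+_; _*_; _%_; _≡ᵇ_; s≤s; z≤n)
import Data.Nat as ℕ
open import Data.Nat.DivMod using (m%n<n)
open import Data.Fin using (Fin; toℕ; fromℕ<)
open import Data.Bool using (Bool; true; false; not; _∧_; if_then_else_)
open import Data.List using (List; []; _∷_; allFin)
open import Data.Bool.ListAction using (any)
open import Data.Empty using (⊥)

data Term (n : ℕ) : Set where
  var  : Fin n → Term n
  zer  : Term n
  _⊕_  : Term n → Term n → Term n
  _⊛_  : Term n → Term n → Term n

-- First-order formulas with equality, connectives ¬, ∧, quantifier ∃,
-- and modular quantifiers ∃^(r,d) indexed by an element of Q.
-- Q = ⊥    : the logic Ring(0,+,*)  (no modular quantifiers)
-- Q = Fin d: the logic Ring(0,+,*)+MOD(d)  (quantifiers ∃^(r,d), 0 ≤ r < d)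
data Form (Q : Set) (n : ℕ) : Set where
  _≐_   : Term n → Term n → Form Q n
  neg   : Form Q n → Form Q n
  _and_ : Form Q n → Form Q n → Form Q n
  ex    : Form Q (suc n) → Form Q n
  modEx : Q → Form Q (suc n) → Form Q n

RingFormula : ℕ → Set
RingFormula = Form ⊥

RingModFormula : ℕ → ℕ → Set
RingModFormula d = Form (Fin d)

RingSentence : Set
RingSentence = RingFormula 0

RingModSentence : ℕ → Set
RingModSentence d = RingModFormula d 0

module Zmod (k : ℕ) where
  m : ℕ
  m = suc k

  red : ℕ → Fin m
  red x = fromℕ< (m%n<n x m)

  addm mulm : Fin m → Fin m → Fin m
  addm a b = red (toℕ a + toℕ b)
  mulm a b = red (toℕ a * toℕ b)

  eqm : Fin m → Fin m → Bool
  eqm a b = toℕ a ≡ᵇ toℕ b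

  Env : ℕ → Set
  Env n = Fin n → Fin m

  extend : ∀ {n} → Fin m → Env n → Env (suc n)
  extend a ρ Fin.zero    = a
  extend a ρ (Fin.suc i) = ρ i

  evalT : ∀ {n} → Env n → Term n → Fin m
  evalT ρ (var i) = ρ i
  evalT ρ zer     = red 0
  evalT ρ (s ⊕ t) = addm (evalT ρ s) (evalT ρ t)
  evalT ρ (s ⊛ t) = mulm (evalT ρ s) (evalT ρ t)

  countTrue : List Bool → ℕ
  countTrue []           = 0
  countTrue (true ∷ bs)  = suc (countTrue bs)
  countTrue (false ∷ bs) = countTrue bs

  mapL : ∀ {A B : Set} → (A → B) → List A → List B
  mapL f []       = []
  mapL f (x ∷ xs) = f x ∷ mapL f xs

  -- Satisfaction, given the interpretation of a modular-quantifier index q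
  -- as a pair (r, d): "number of witnesses ≡ r (mod d)" is decided by
  -- modTest q c, where c is the number of witnesses.
  sat : ∀ {Q : Set} (modTest : Q → ℕ → Bool) {n} → Env n → Form Q n → Bool
  sat mt ρ (s ≐ t)     = eqm (evalT ρ s) (evalT ρ t)
  sat mt ρ (neg φ)     = not (sat mt ρ φ)
  sat mt ρ (φ and ψ)   = sat mt ρ φ ∧ sat mt ρ ψ
  sat mt ρ (ex φ)      = any (λ a → sat mt (extend a ρ) φ) (allFin m)
  sat mt ρ (modEx q φ) =
    mt q (countTrue (mapL (λ a → sat mt (extend a ρ) φ) (allFin m)))

  emptyEnv : Env 0
  emptyEnv ()

modTest : (d : ℕ) → Fin d → ℕ → Bool
modTest zero    () c
modTest (suc e) r c = (c % suc e) ≡ᵇ toℕ r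

noMod : ⊥ → ℕ → Bool
noMod ()

-- Z_{suc k} ⊨ σ  for σ a Ring(0,+,*) sentence
_⊨R_ : ℕ → RingSentence → Bool
k ⊨R σ = Zmod.sat k noMod (Zmod.emptyEnv k) σ

-- Z_{suc k} ⊨ θ  for θ a Ring(0,+,*)+MOD(d) sentence
⊨M : (d : ℕ) → ℕ → RingModSentence d → Bool
⊨M d k θ = Zmod.sat k (modTest d) (Zmod.emptyEnv k) θ

embed : ∀ {d n} → RingFormula n → RingModFormula d n
embed (s ≐ t)     = s ≐ t
embed (neg φ)     = neg (embed φ)
embed (φ and ψ)   = embed φ and embed ψ
embed (ex φ)      = ex (embed φ)
embed (modEx () φ)

{-# OPTIONS --safe #-}

-- To every Ring(0,+,*) formula φ one attaches a finite commutative semigroup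
-- and a value of (ℤ_m , ρ) in it which decides whether φ holds and which, by
-- the Chinese remainder theorem, is multiplicative: the value over ℤ_{ab} is
-- the product of the values over ℤ_a and ℤ_b for coprime a and b.  Atomic
-- formulas use (Bool , ∧), conjunction uses products, and ∃ uses the semigroup
-- of subsets.  All these semigroups are J-trivial, so that a sequence
-- descending for divisibility has two equal consecutive terms.  For the
-- sequence P₀ = 1, Pᵢ₊₁ = Pᵢ (d Pᵢ − 1), a fixed sentence therefore does not
-- distinguish some Pᵢ from Pᵢ₊₁.  But Pᵢ is alternately 1 and −1 modulo d, so
-- "m ≡ 1 mod d" does distinguish them when d > 2.
module Submission where

open import Defs
open import Data.Nat using (ℕ; suc; _>_)
open import Data.Bool using (Bool)
open import Data.Product using (_×_; ∃)
open import Relation.Binary.PropositionalEquality using (_≡_)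
open import Relation.Nullary using (¬_)

open import Data.Bool using (true; false; not; _∧_; T)
import Data.Bool.Properties as Bool
open import Data.Bool.ListAction using (any; or)
open import Data.Fin using (Fin; zero; suc; toℕ)
import Data.Fin.Properties as Fin
open import Data.List using (length; []; _∷_; allFin)
open import Data.List.Membership.Propositional using (lose)
open import Data.List.Membership.Propositional.Properties using (∈-allFin)
open import Data.List.Properties using (map-cong; length-tabulate)
import Data.List.Relation.Unary.Any as Any
import Data.List.Relation.Unary.Any.Properties as Any
open import Data.Nat using (zero; _+_; _*_; _%_; _<_; _<′_; ≤′-refl; ≤′-step; z≤n; s≤s)
open import Data.Nat.Divisibility using (_∣_; m∣m*n; n∣m*n)
open import Data.Nat.DivMod
import Data.Nat.Properties as ℕ
open import Data.Nat.Tactic.RingSolver using (solve-∀)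
open import Data.Product using (_,_; proj₁; proj₂; ∃₂)
open import Data.Product.Function.NonDependent.Propositional using (_×-↔_)
open import Data.Sum using (_⊎_; inj₁; inj₂)
open import Data.Vec using (Vec; []; _∷_; lookup; tabulate)
open import Data.Vec.Properties using (lookup∘tabulate; tabulate∘lookup; tabulate-cong)
open import Function using (_∘_; flip; _↔_; _⇔_; mk⇔; mk↔ₛ′; Equivalence; Inverse)
open import Function.Construct.Composition using (_↔-∘_)
open import Function.Construct.Symmetry using (↔-sym)
open import Function.Properties.Inverse using (Inverse⇒Injection)
open import Relation.Binary.Definitions using (DecidableEquality; Transitive; Antisymmetric)
open import Relation.Binary.PropositionalEquality
  using (refl; sym; trans; cong; cong₂; subst; subst₂)
open import Relation.Nullary using (Dec; yes; does)
open import Relation.Nullary.Decidable using (map′; _×-dec_; T?; does-⇔; dec-true; via-injection)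
open import Relation.Unary using (Decidable)

-- Finite types and their subsets

Finite : Set → Set
Finite A = ∃ λ n → A ↔ Fin n

Bool-finite : Finite Bool
Bool-finite = 2 , ↔-sym Fin.2↔Bool

×-finite : ∀ {A B} → Finite A → Finite B → Finite (A × B)
×-finite (m , f) (n , g) = m * n , ↔-sym Fin.*↔× ↔-∘ (f ×-↔ g)

Vec-Bool-finite : ∀ n → Finite (Vec Bool n)
Vec-Bool-finite zero    = 1 , mk↔ₛ′ (λ _ → zero) (λ _ → []) (λ { zero → refl }) (λ { [] → refl })
Vec-Bool-finite (suc n) with ×-finite Bool-finite (Vec-Bool-finite n)
... | s , f = s , f ↔-∘ uncons
  where
  uncons : Vec Bool (suc n) ↔ (Bool × Vec Bool n)
  uncons = mk↔ₛ′ (λ { (b ∷ bs) → b , bs }) (λ { (b , bs) → b ∷ bs })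
                 (λ { (b , bs) → refl }) (λ { (b ∷ bs) → refl })

module FiniteType {A : Set} (finite : Finite A) where

  open Inverse (proj₂ finite) using (to; from; strictlyInverseˡ; strictlyInverseʳ)

  infix 4 _≟_ _∈_ _∈?_

  _≟_ : DecidableEquality A
  _≟_ = via-injection (Inverse⇒Injection (proj₂ finite)) Fin._≟_

  any? : ∀ {P : A → Set} → Decidable P → Dec (∃ P)
  any? {P} P? = map′ (λ (i , p) → from i , p)
                     (λ (x , p) → to x , subst P (sym (strictlyInverseʳ x)) p)
                     (Fin.any? (P? ∘ from))

  repetition : (w : ℕ → A) → ∃₂ λ i j → i < j × w i ≡ w j
  repetition w with Fin.pigeonhole ℕ.≤-refl (to ∘ w ∘ toℕ)
  ... | i , j , i<j , eq =
    toℕ i , toℕ j , i<j ,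
    trans (sym (strictlyInverseʳ _)) (trans (cong from eq) (strictlyInverseʳ _))

  -- By pigeonhole w i = w j for some i < j. The chain from i + 1 up to j closes into a cycle
  -- through w i, which antisymmetry collapses. As R need not be reflexive, the case j = i + 1 is
  -- treated apart.
  stationary : ∀ {R : A → A → Set} → Transitive R → Antisymmetric _≡_ R →
               (w : ℕ → A) → (∀ i → R (w i) (w (suc i))) → ∃ λ i → w i ≡ w (suc i)
  stationary {R} R-trans R-antisym w step with repetition w
  ... | i , j , i<j , wi≡wj = i , go (ℕ.m≤n⇒m<n∨m≡n i<j)
    where
    chain : ∀ {k l} → k <′ l → R (w k) (w l)
    chain ≤′-refl       = step _
    chain (≤′-step k<l) = R-trans (chain k<l) (step _)

    go : suc i < j ⊎ suc i ≡ j → w i ≡ w (suc i)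
    go (inj₁ si<j) = R-antisym (step i) (subst (R (w (suc i))) (sym wi≡wj) (chain (ℕ.≤⇒≤′ si<j)))
    go (inj₂ refl) = wi≡wj

  -- Bit vectors rather than predicates: subsets form a finite type again, and extensionally equal
  -- ones are propositionally equal.
  Subset : Set
  Subset = Vec Bool (proj₁ finite)

  _∈_ : A → Subset → Set
  x ∈ S = lookup S (to x) ≡ true

  _∈?_ : ∀ x S → Dec (x ∈ S)
  x ∈? S = lookup S (to x) Bool.≟ true

  ⟦_⟧ : ∀ {P : A → Set} → Decidable P → Subset
  ⟦ P? ⟧ = tabulate (does ∘ P? ∘ from)

  ∈⟦_⟧ : ∀ {P : A → Set} (P? : Decidable P) {x} → x ∈ ⟦ P? ⟧ ⇔ P x
  ∈⟦_⟧ {P} P? {x} = mk⇔ (decode ∘ trans (sym does-at-x)) (trans does-at-x ∘ dec-true (P? x))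
    where
    does-at-x : lookup ⟦ P? ⟧ (to x) ≡ does (P? x)
    does-at-x = trans (lookup∘tabulate _ (to x)) (cong (does ∘ P?) (strictlyInverseʳ x))

    decode : does (P? x) ≡ true → P x
    decode eq with yes p ← P? x = p

  ⊆-antisym : ∀ {S U} → (∀ {x} → x ∈ S → x ∈ U) → (∀ {x} → x ∈ U → x ∈ S) → S ≡ U
  ⊆-antisym {S} {U} S⊆U U⊆S =
    trans (sym (tabulate∘lookup S)) (trans (tabulate-cong same) (tabulate∘lookup U))
    where
    same : ∀ i → lookup S i ≡ lookup U i
    same i = subst (λ j → lookup S j ≡ lookup U j) (strictlyInverseˡ i)
                   (Bool.⇔→≡ (mk⇔ (S⊆U {from i}) U⊆S))

-- Finite J-trivial commutative semigroups

record FiniteJTrivialSemigroup : Set₁ where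
  infixl 7 _∙_
  field
    Carrier : Set
    _∙_     : Carrier → Carrier → Carrier
    assoc   : ∀ x y z → (x ∙ y) ∙ z ≡ x ∙ (y ∙ z)
    comm    : ∀ x y → x ∙ y ≡ y ∙ x
    -- J-triviality in a form without a unit: an element and a multiple of it that divides it back
    -- are equal. This is antisymmetry of `_∣∙_`.
    absorb  : ∀ {x u v} → x ≡ x ∙ u ∙ v → x ≡ x ∙ u
    finite  : Finite Carrier

  open FiniteType finite public

  _∣∙_ : Carrier → Carrier → Set
  x ∣∙ y = ∃ λ u → y ≡ x ∙ u

  ∣∙-trans : Transitive _∣∙_
  ∣∙-trans {x} (u , refl) (v , refl) = u ∙ v , assoc x u v

  ∣∙-antisym : Antisymmetric _≡_ _∣∙_
  ∣∙-antisym (u , y≡xu) (v , x≡yv) =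
    trans (absorb (trans x≡yv (cong (_∙ v) y≡xu))) (sym y≡xu)

  swapʳ : ∀ x u v → x ∙ u ∙ v ≡ x ∙ v ∙ u
  swapʳ x u v = trans (assoc x u v) (trans (cong (x ∙_) (comm u v)) (sym (assoc x v u)))

∧-semigroup : FiniteJTrivialSemigroup
∧-semigroup = record
  { Carrier = Bool
  ; _∙_     = _∧_
  ; assoc   = Bool.∧-assoc
  ; comm    = Bool.∧-comm
  ; absorb  = λ {x} {u} → ∧-absorb x u
  ; finite  = Bool-finite
  }
  where
  ∧-absorb : ∀ x u {v} → x ≡ (x ∧ u) ∧ v → x ≡ x ∧ u
  ∧-absorb false _    _ = refl
  ∧-absorb true  true _ = refl

×-semigroup : FiniteJTrivialSemigroup → FiniteJTrivialSemigroup → FiniteJTrivialSemigroup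
×-semigroup G H = record
  { Carrier = G.Carrier × H.Carrier
  ; _∙_     = λ (x , y) (x′ , y′) → x G.∙ x′ , y H.∙ y′
  ; assoc   = λ _ _ _ → cong₂ _,_ (G.assoc _ _ _) (H.assoc _ _ _)
  ; comm    = λ _ _ → cong₂ _,_ (G.comm _ _) (H.comm _ _)
  ; absorb  = λ eq → cong₂ _,_ (G.absorb (cong proj₁ eq)) (H.absorb (cong proj₂ eq))
  ; finite  = ×-finite G.finite H.finite
  }
  where
  module G = FiniteJTrivialSemigroup G
  module H = FiniteJTrivialSemigroup H

-- The power semigroup

module Power (G : FiniteJTrivialSemigroup) where

  open FiniteJTrivialSemigroup G

  infixl 7 _⊙_

  IsProduct : Subset → Subset → Carrier → Set
  IsProduct S U z = ∃ λ x → ∃ λ y → x ∈ S × y ∈ U × z ≡ x ∙ y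

  isProduct? : ∀ S U → Decidable (IsProduct S U)
  isProduct? S U z = any? λ x → any? λ y → (x ∈? S) ×-dec (y ∈? U) ×-dec (z ≟ x ∙ y)

  _⊙_ : Subset → Subset → Subset
  S ⊙ U = ⟦ isProduct? S U ⟧

  ∈⊙⁻ : ∀ {S U z} → z ∈ S ⊙ U → IsProduct S U z
  ∈⊙⁻ {S} {U} = Equivalence.to ∈⟦ isProduct? S U ⟧

  ∈⊙⁺ : ∀ {S U x y} → x ∈ S → y ∈ U → x ∙ y ∈ S ⊙ U
  ∈⊙⁺ {S} {U} x∈S y∈U = Equivalence.from ∈⟦ isProduct? S U ⟧ (_ , _ , x∈S , y∈U , refl)

  ⊙-comm : ∀ S U → S ⊙ U ≡ U ⊙ S
  ⊙-comm S U = ⊆-antisym (sub S U) (sub U S)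
    where
    sub : ∀ S U {z} → z ∈ S ⊙ U → z ∈ U ⊙ S
    sub S U z∈ with x , y , x∈ , y∈ , refl ← ∈⊙⁻ {S} {U} z∈ =
      subst (_∈ U ⊙ S) (comm y x) (∈⊙⁺ {U} {S} y∈ x∈)

  ⊙-assoc : ∀ S U V → (S ⊙ U) ⊙ V ≡ S ⊙ (U ⊙ V)
  ⊙-assoc S U V = ⊆-antisym to from
    where
    to : ∀ {z} → z ∈ (S ⊙ U) ⊙ V → z ∈ S ⊙ (U ⊙ V)
    to z∈ with _ , v , xu∈ , v∈ , refl ← ∈⊙⁻ {S ⊙ U} {V} z∈
          with x , u , x∈ , u∈ , refl ← ∈⊙⁻ {S} {U} xu∈ =
      subst (_∈ S ⊙ (U ⊙ V)) (sym (assoc x u v)) (∈⊙⁺ {S} {U ⊙ V} x∈ (∈⊙⁺ {U} {V} u∈ v∈))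

    from : ∀ {z} → z ∈ S ⊙ (U ⊙ V) → z ∈ (S ⊙ U) ⊙ V
    from z∈ with x , _ , x∈ , uv∈ , refl ← ∈⊙⁻ {S} {U ⊙ V} z∈
            with u , v , u∈ , v∈ , refl ← ∈⊙⁻ {U} {V} uv∈ =
      subst (_∈ (S ⊙ U) ⊙ V) (assoc x u v) (∈⊙⁺ {S ⊙ U} {V} (∈⊙⁺ {S} {U} x∈ u∈) v∈)

  module _ {S U V : Subset} (S≡SUV : S ≡ S ⊙ U ⊙ V) where

    -- Unlike in `factor`, the same element stands on both sides, so `absorb` of the base semigroup
    -- applies to it.
    Stable : Carrier → Set
    Stable x = ∃ λ u → ∃ λ v → u ∈ U × v ∈ V × x ≡ x ∙ u ∙ v

    factor : ∀ {x} → x ∈ S → ∃ λ y → ∃ λ u → ∃ λ v → y ∈ S × u ∈ U × v ∈ V × x ≡ y ∙ u ∙ v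
    factor {x} x∈S with _ , v , yu∈ , v∈ , refl ← ∈⊙⁻ {S ⊙ U} {V} (subst (x ∈_) S≡SUV x∈S)
                   with y , u , y∈ , u∈ , refl ← ∈⊙⁻ {S} {U} yu∈ =
      y , u , v , y∈ , u∈ , v∈ , refl

    -- Factoring repeatedly gives x = x₀, xᵢ = xᵢ₊₁ ∙ uᵢ ∙ vᵢ; this chain becomes
    -- stationary, and stability passes from xᵢ to its multiple x.
    stable : ∀ {x} → x ∈ S → Stable x
    stable {x} x∈S = pull-back i stable-at-i
      where
      chain : ℕ → ∃ (_∈ S)
      chain zero    = x , x∈S
      chain (suc i) with y , _ , _ , y∈S , _ ← factor (proj₂ (chain i)) = y , y∈S

      w : ℕ → Carrier
      w = proj₁ ∘ chain

      step : ∀ i → ∃ λ u → ∃ λ v → u ∈ U × v ∈ V × w i ≡ w (suc i) ∙ u ∙ v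
      step i with _ , u , v , _ , u∈ , v∈ , eq ← factor (proj₂ (chain i)) = u , v , u∈ , v∈ , eq

      w-descends : ∀ i → w (suc i) ∣∙ w i
      w-descends i with u , v , _ , _ , eq ← step i = u ∙ v , trans eq (assoc _ u v)

      stat : ∃ λ i → w i ≡ w (suc i)
      stat = stationary {R = flip _∣∙_} (flip ∣∙-trans) (flip ∣∙-antisym) w w-descends

      i : ℕ
      i = proj₁ stat

      stable-at-i : Stable (w i)
      stable-at-i with u , v , u∈ , v∈ , eq ← step i =
        u , v , u∈ , v∈ , trans eq (cong (λ y → y ∙ u ∙ v) (sym (proj₂ stat)))

      stable-multiple : ∀ {y z} → y ∣∙ z → Stable y → Stable z
      stable-multiple {y} (t , refl) (u , v , u∈ , v∈ , eq) = u , v , u∈ , v∈ ,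
        trans (cong (_∙ t) eq) (trans (swapʳ (y ∙ u) v t) (cong (_∙ v) (swapʳ y u t)))

      pull-back : ∀ i → Stable (w i) → Stable x
      pull-back zero    s = s
      pull-back (suc i) s = pull-back i (stable-multiple (w-descends i) s)

    -- Each x in S is stable, x = x ∙ u ∙ v, hence x = x ∙ u lies in S ⊙ U. With u and v exchanged
    -- also x = x ∙ v, so x ∙ y = x ∙ y ∙ v lies in S ⊙ U ⊙ V = S for every y in U.
    ⊙-absorb : S ≡ S ⊙ U
    ⊙-absorb = ⊆-antisym S⊆SU SU⊆S
      where
      S⊆SU : ∀ {x} → x ∈ S → x ∈ S ⊙ U
      S⊆SU x∈ with u , v , u∈ , _ , eq ← stable x∈ =
        subst (_∈ S ⊙ U) (sym (absorb eq)) (∈⊙⁺ {S} {U} x∈ u∈)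

      SU⊆S : ∀ {z} → z ∈ S ⊙ U → z ∈ S
      SU⊆S z∈ with x , y , x∈ , y∈ , refl ← ∈⊙⁻ {S} {U} z∈
              with u , v , _ , v∈ , eq ← stable x∈ =
        subst (x ∙ y ∈_) (sym S≡SUV)
          (subst (_∈ S ⊙ U ⊙ V) xyv≡xy (∈⊙⁺ {S ⊙ U} {V} (∈⊙⁺ {S} {U} x∈ y∈) v∈))
        where
        xyv≡xy : x ∙ y ∙ v ≡ x ∙ y
        xyv≡xy = trans (swapʳ x y v) (cong (_∙ y) (sym (absorb (trans eq (swapʳ x u v)))))

  semigroup : FiniteJTrivialSemigroup
  semigroup = record
    { Carrier = Subset
    ; _∙_     = _⊙_
    ; assoc   = ⊙-assoc
    ; comm    = ⊙-comm
    ; absorb  = λ {S} {U} {V} → ⊙-absorb {S} {U} {V}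
    ; finite  = Vec-Bool-finite _
    }

-- Residue class rings

-- Defined on representatives for any two moduli; compatibility with the ring operations is proved
-- where `suc k` divides `suc c`.
reduce : ∀ {c} k → Fin (suc c) → Fin (suc k)
reduce k x = Zmod.red k (toℕ x)

infix 4 _≡_[mod1+_]

-- A record rather than a synonym, so that x and y can be inferred.
record _≡_[mod1+_] (x y k : ℕ) : Set where
  constructor %-≡
  field
    ≡-% : x % suc k ≡ y % suc k

module _ {k : ℕ} where

  mod-refl : ∀ {x} → x ≡ x [mod1+ k ]
  mod-refl = %-≡ refl

  mod-sym : ∀ {x y} → x ≡ y [mod1+ k ] → y ≡ x [mod1+ k ]
  mod-sym (%-≡ p) = %-≡ (sym p)

  mod-trans : ∀ {x y z} → x ≡ y [mod1+ k ] → y ≡ z [mod1+ k ] → x ≡ z [mod1+ k ]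
  mod-trans (%-≡ p) (%-≡ q) = %-≡ (trans p q)

  mod-reflexive : ∀ {x y} → x ≡ y → x ≡ y [mod1+ k ]
  mod-reflexive refl = mod-refl

  mod-+ : ∀ {x x′ y y′} → x ≡ x′ [mod1+ k ] → y ≡ y′ [mod1+ k ] → x + y ≡ x′ + y′ [mod1+ k ]
  mod-+ {x} {x′} {y} {y′} (%-≡ p) (%-≡ q) = %-≡
    (trans (%-distribˡ-+ x y (suc k))
      (trans (cong₂ (λ s t → (s + t) % suc k) p q) (sym (%-distribˡ-+ x′ y′ (suc k)))))

  mod-* : ∀ {x x′ y y′} → x ≡ x′ [mod1+ k ] → y ≡ y′ [mod1+ k ] → x * y ≡ x′ * y′ [mod1+ k ]
  mod-* {x} {x′} {y} {y′} (%-≡ p) (%-≡ q) = %-≡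
    (trans (%-distribˡ-* x y (suc k))
      (trans (cong₂ (λ s t → (s * t) % suc k) p q) (sym (%-distribˡ-* x′ y′ (suc k)))))

  mod-multiple : ∀ x n → x + n * suc k ≡ x [mod1+ k ]
  mod-multiple x n = %-≡ ([m+kn]%n≡m%n x n (suc k))

-- This makes each summand of the Chinese remainder formula depend only on a residue modulo one of
-- the two factors.
mod-scale : ∀ {c a x y} b → suc c ≡ suc a * suc b →
            x ≡ y [mod1+ a ] → x * suc b ≡ y * suc b [mod1+ c ]
mod-scale {a = a} {x} {y} b refl (%-≡ p) = %-≡
  (trans (sym (m%n*o≡m*o%[n*o] x (suc a) (suc b)))
    (trans (cong (_* suc b) p) (m%n*o≡m*o%[n*o] y (suc a) (suc b))))

toℕ-red : ∀ k x → toℕ (Zmod.red k x) ≡ x % suc k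
toℕ-red k x = Fin.toℕ-fromℕ< (m%n<n x (suc k))

red-cong : ∀ k {x y} → x ≡ y [mod1+ k ] → Zmod.red k x ≡ Zmod.red k y
red-cong k {x} {y} (%-≡ p) = Fin.toℕ-injective (trans (toℕ-red k x) (trans p (sym (toℕ-red k y))))

red-injective : ∀ k x y → Zmod.red k x ≡ Zmod.red k y → x ≡ y [mod1+ k ]
red-injective k x y eq = %-≡ (trans (sym (toℕ-red k x)) (trans (cong toℕ eq) (toℕ-red k y)))

red-toℕ : ∀ {k} (x : Fin (suc k)) → Zmod.red k (toℕ x) ≡ x
red-toℕ {k} x = Fin.toℕ-injective (trans (toℕ-red k (toℕ x)) (m<n⇒m%n≡m (Fin.toℕ<n x)))

reduce-red : ∀ c k → suc k ∣ suc c → ∀ x → reduce k (Zmod.red c x) ≡ Zmod.red k x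
reduce-red c k k∣c x = red-cong k {toℕ (Zmod.red c x)} {x} (%-≡
  (trans (cong (_% suc k) (toℕ-red c x)) (m∣n⇒o%n%m≡o%m (suc k) (suc c) x k∣c)))

toℕ-reduce : ∀ {c} k (x : Fin (suc c)) → toℕ x ≡ toℕ (reduce k x) [mod1+ k ]
toℕ-reduce k x = %-≡
  (sym (trans (cong (_% suc k) (toℕ-red k (toℕ x))) (m%n%n≡m%n (toℕ x) (suc k))))

module Reduction (c k : ℕ) (k∣c : suc k ∣ suc c) {n : ℕ}
                 (ρ : Zmod.Env c n) (ρ′ : Zmod.Env k n) (ρ↦ρ′ : ∀ i → reduce k (ρ i) ≡ ρ′ i) where

  module C = Zmod c
  module K = Zmod k

  reduce-addm : ∀ x y → reduce k (C.addm x y) ≡ K.addm (reduce k x) (reduce k y)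
  reduce-addm x y = trans (reduce-red c k k∣c (toℕ x + toℕ y))
                          (red-cong k (mod-+ (toℕ-reduce k x) (toℕ-reduce k y)))

  reduce-mulm : ∀ x y → reduce k (C.mulm x y) ≡ K.mulm (reduce k x) (reduce k y)
  reduce-mulm x y = trans (reduce-red c k k∣c (toℕ x * toℕ y))
                          (red-cong k (mod-* (toℕ-reduce k x) (toℕ-reduce k y)))

  reduce-evalT : ∀ t → reduce k (C.evalT ρ t) ≡ K.evalT ρ′ t
  reduce-evalT (var i) = ρ↦ρ′ i
  reduce-evalT zer     = reduce-red c k k∣c 0
  reduce-evalT (s ⊕ t) = trans (reduce-addm (C.evalT ρ s) (C.evalT ρ t))
                               (cong₂ K.addm (reduce-evalT s) (reduce-evalT t))
  reduce-evalT (s ⊛ t) = trans (reduce-mulm (C.evalT ρ s) (C.evalT ρ t))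
                               (cong₂ K.mulm (reduce-evalT s) (reduce-evalT t))

-- ℤ_{1+c} ≅ ℤ_{1+a} × ℤ_{1+b} by reduction.
record Splits (c a b : ℕ) : Set where
  field
    ∣ˡ         : suc a ∣ suc c
    ∣ʳ         : suc b ∣ suc c
    injective  : ∀ {x y : Fin (suc c)} → reduce a x ≡ reduce a y → reduce b x ≡ reduce b y → x ≡ y
    surjective : ∀ x y → ∃ λ (z : Fin (suc c)) → reduce a z ≡ x × reduce b z ≡ y

-- The Chinese remainder theorem for A = 1+a and B = 1+b with d A = 1 + B, where
-- 1 + A B = d A + a B exhibits the idempotents d A and a B of ℤ_{AB}.
module ChineseRemainder (d a b : ℕ) (bezout : d * suc a ≡ suc (suc b)) where

  c A B : ℕ
  c = b + a * suc b
  A = suc a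
  B = suc b

  -- Modulo A both a and B are -1, so a B is 1 there and 0 modulo B; d A = 1 + B is 1 modulo B and 0
  -- modulo A. Hence the result has residue r modulo A and s modulo B.
  combine : ℕ → ℕ → ℕ
  combine r s = d * (s * A) + a * (r * B)

  combine-cong : ∀ {r r′ s s′} → r ≡ r′ [mod1+ a ] → s ≡ s′ [mod1+ b ] →
                 combine r s ≡ combine r′ s′ [mod1+ c ]
  combine-cong p q = mod-+ (mod-* (mod-refl {x = d}) (mod-scale a (ℕ.*-comm A B) q))
                           (mod-* (mod-refl {x = a}) (mod-scale b refl p))

  d*[s*A] : ∀ s → d * (s * A) ≡ s * suc B
  d*[s*A] s = trans (swap d s A) (cong (s *_) bezout)
    where
    swap : ∀ d s A → d * (s * A) ≡ s * (d * A)
    swap = solve-∀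

  combine-s*suc-B : ∀ r s → combine r s ≡ s * suc B + a * (r * B)
  combine-s*suc-B r s = cong (_+ a * (r * B)) (d*[s*A] s)

  combine-diagonal : ∀ x → combine x x ≡ x [mod1+ c ]
  combine-diagonal x =
    mod-trans (mod-reflexive (trans (combine-s*suc-B x x) (expand x a B))) (mod-multiple x x)
    where
    expand : ∀ x a B → x * suc B + a * (x * B) ≡ x + x * (B + a * B)
    expand = solve-∀

  combine-modA : ∀ r s → combine r s ≡ r [mod1+ a ]
  combine-modA r s =
    -- The argument s enters only through a multiple of A, so it may be replaced by r; then
    -- `combine r r` is r plus a multiple of A.
    mod-trans (mod-reflexive (shift d s A (a * (r * B))))
      (mod-trans (mod-multiple (a * (r * B)) (d * s))
        (mod-trans (mod-sym (mod-multiple (a * (r * B)) (d * r)))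
          (mod-trans (mod-reflexive a*rB+dr*A) (mod-multiple r (r * B)))))
    where
    shift : ∀ d s A t → d * (s * A) + t ≡ t + (d * s) * A
    shift = solve-∀
    expand : ∀ r a B → r * suc B + a * (r * B) ≡ r + r * B * suc a
    expand = solve-∀
    a*rB+dr*A : a * (r * B) + (d * r) * A ≡ r + r * B * A
    a*rB+dr*A = trans (sym (shift d r A (a * (r * B))))
                  (trans (combine-s*suc-B r r) (expand r a B))

  combine-modB : ∀ r s → combine r s ≡ s [mod1+ b ]
  combine-modB r s =
    mod-trans (mod-reflexive (trans (combine-s*suc-B r s) (expand r s a B))) (mod-multiple s (s + a * r))
    where
    expand : ∀ r s a B → s * suc B + a * (r * B) ≡ s + (s + a * r) * B
    expand = solve-∀

  splits : Splits c a b
  splits = record { ∣ˡ = A∣C ; ∣ʳ = B∣C ; injective = injective ; surjective = surjective }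
    where
    A∣C : A ∣ suc c
    A∣C = m∣m*n B

    B∣C : B ∣ suc c
    B∣C = n∣m*n A

    injective : ∀ {x y : Fin (suc c)} → reduce a x ≡ reduce a y → reduce b x ≡ reduce b y → x ≡ y
    injective {x} {y} p q = trans (sym (red-toℕ x)) (trans (red-cong c x≡y) (red-toℕ y))
      where
      x≡y : toℕ x ≡ toℕ y [mod1+ c ]
      -- Each number is congruent to its own recombination, which depends only on the two residues.
      x≡y = mod-trans (mod-sym (combine-diagonal (toℕ x)))
              (mod-trans (combine-cong (red-injective a (toℕ x) (toℕ y) p)
                                       (red-injective b (toℕ x) (toℕ y) q))
                (combine-diagonal (toℕ y)))

    surjective : ∀ x y → ∃ λ (z : Fin (suc c)) → reduce a z ≡ x × reduce b z ≡ y
    surjective x y = Zmod.red c z ,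
      trans (reduce-red c a A∣C z) (trans (red-cong a (combine-modA (toℕ x) (toℕ y))) (red-toℕ x)) ,
      trans (reduce-red c b B∣C z) (trans (red-cong b (combine-modB (toℕ x) (toℕ y))) (red-toℕ y))
      where
      z : ℕ
      z = combine (toℕ x) (toℕ y)

-- The semigroup of a formula

open FiniteJTrivialSemigroup using (Carrier)

-- Negation keeps both semigroup and value and is applied only when `holds` reads the value off,
-- since Boolean negation does not respect `_∧_`.
semigroup : ∀ {n} → RingFormula n → FiniteJTrivialSemigroup
semigroup (s ≐ t)   = ∧-semigroup
semigroup (neg φ)   = semigroup φ
semigroup (φ and ψ) = ×-semigroup (semigroup φ) (semigroup ψ)
semigroup (ex φ)    = Power.semigroup (semigroup φ)

holds : ∀ {n} (φ : RingFormula n) → Carrier (semigroup φ) → Bool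
holds (s ≐ t)   b       = b
holds (neg φ)   x       = not (holds φ x)
holds (φ and ψ) (x , y) = holds φ x ∧ holds ψ y
holds (ex φ)    S       = does (any? λ z → (z ∈? S) ×-dec T? (holds φ z))
  where open FiniteJTrivialSemigroup (semigroup φ)

-- For ∃ the values at all witnesses are recorded, not just whether one satisfies φ: the truth of φ
-- over two factors need not determine its truth over their product, whereas the values do.
value : ∀ {n} (φ : RingFormula n) k → Zmod.Env k n → Carrier (semigroup φ)

isValue? : ∀ {n} (φ : RingFormula (suc n)) k (ρ : Zmod.Env k n) →
           Decidable λ z → ∃ λ x → value φ k (Zmod.extend k x ρ) ≡ z

value (s ≐ t)   k ρ = does (Zmod.evalT k ρ s Fin.≟ Zmod.evalT k ρ t)
value (neg φ)   k ρ = value φ k ρ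
value (φ and ψ) k ρ = value φ k ρ , value ψ k ρ
value (ex φ)    k ρ = FiniteJTrivialSemigroup.⟦_⟧ (semigroup φ) (isValue? φ k ρ)

isValue? φ k ρ z = Fin.any? λ x → value φ k (Zmod.extend k x ρ) ≟ z
  where open FiniteJTrivialSemigroup (semigroup φ)

any-allFin : ∀ {n} (p : Fin n → Bool) → T (any p (allFin n)) ⇔ ∃ (T ∘ p)
any-allFin p = mk⇔ (Any.satisfied ∘ Any.any⁻ p (allFin _))
                   (λ (x , px) → Any.any⁺ p (lose (∈-allFin x) px))

sat-value : ∀ {n} (φ : RingFormula n) k (ρ : Zmod.Env k n) →
            Zmod.sat k noMod ρ φ ≡ holds φ (value φ k ρ)
sat-value (s ≐ t)   k ρ =
  -- `eqm` is by computation the Boolean part of the decision of equality on ℕ.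
  does-⇔ (mk⇔ Fin.toℕ-injective (cong toℕ)) (toℕ x ℕ.≟ toℕ y) (x Fin.≟ y)
  where
  x y : Fin (suc k)
  x = Zmod.evalT k ρ s
  y = Zmod.evalT k ρ t
sat-value (neg φ)   k ρ = cong not (sat-value φ k ρ)
sat-value (φ and ψ) k ρ = cong₂ _∧_ (sat-value φ k ρ) (sat-value ψ k ρ)
sat-value (ex φ)    k ρ =
  does-⇔ (mk⇔ to from) (T? _) (any? λ z → (z ∈? value (ex φ) k ρ) ×-dec T? (holds φ z))
  where
  open FiniteJTrivialSemigroup (semigroup φ)

  body : Fin (suc k) → Bool
  body x = Zmod.sat k noMod (Zmod.extend k x ρ) φ

  to : T (any body (allFin (suc k))) → ∃ λ z → z ∈ value (ex φ) k ρ × T (holds φ z)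
  to h with x , px ← Equivalence.to (any-allFin body) h =
    value φ k (Zmod.extend k x ρ) , Equivalence.from ∈⟦ isValue? φ k ρ ⟧ (x , refl) ,
    subst T (sat-value φ k (Zmod.extend k x ρ)) px

  from : (∃ λ z → z ∈ value (ex φ) k ρ × T (holds φ z)) → T (any body (allFin (suc k)))
  from (z , z∈ , hz) with x , refl ← Equivalence.to ∈⟦ isValue? φ k ρ ⟧ z∈ =
    Equivalence.from (any-allFin body) (x , subst T (sym (sat-value φ k (Zmod.extend k x ρ))) hz)

-- Multiplicativity of values

module _ {c a b : ℕ} (split : Splits c a b) where

  open Splits split

  -- An equation holds in the product ring iff it holds in both factors. Under ∃, witnesses
  -- correspond to pairs of witnesses in the factors, so the sets of values multiply elementwise.
  value-∙ : ∀ {n} (φ : RingFormula n) {ρ : Zmod.Env c n} {ρ₁ : Zmod.Env a n} {ρ₂ : Zmod.Env b n} →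
            (∀ i → reduce a (ρ i) ≡ ρ₁ i) → (∀ i → reduce b (ρ i) ≡ ρ₂ i) →
            value φ c ρ ≡ FiniteJTrivialSemigroup._∙_ (semigroup φ) (value φ a ρ₁) (value φ b ρ₂)
  value-∙ (s ≐ t) {ρ} {ρ₁} {ρ₂} eq₁ eq₂ =
    does-⇔ (mk⇔ (λ x≡y → to₁ (cong (reduce a) x≡y) , to₂ (cong (reduce b) x≡y))
                (λ (p , q) → injective (from₁ p) (from₂ q)))
           (Zmod.evalT c ρ s Fin.≟ Zmod.evalT c ρ t)
           ((Zmod.evalT a ρ₁ s Fin.≟ Zmod.evalT a ρ₁ t) ×-dec (Zmod.evalT b ρ₂ s Fin.≟ Zmod.evalT b ρ₂ t))
    where
    ev₁ : ∀ t → reduce a (Zmod.evalT c ρ t) ≡ Zmod.evalT a ρ₁ t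
    ev₁ = Reduction.reduce-evalT c a ∣ˡ ρ ρ₁ eq₁
    ev₂ : ∀ t → reduce b (Zmod.evalT c ρ t) ≡ Zmod.evalT b ρ₂ t
    ev₂ = Reduction.reduce-evalT c b ∣ʳ ρ ρ₂ eq₂
    to₁ = subst₂ _≡_ (ev₁ s) (ev₁ t)
    to₂ = subst₂ _≡_ (ev₂ s) (ev₂ t)
    from₁ = subst₂ _≡_ (sym (ev₁ s)) (sym (ev₁ t))
    from₂ = subst₂ _≡_ (sym (ev₂ s)) (sym (ev₂ t))
  value-∙ (neg φ)   eq₁ eq₂ = value-∙ φ eq₁ eq₂
  value-∙ (φ and ψ) eq₁ eq₂ = cong₂ _,_ (value-∙ φ eq₁ eq₂) (value-∙ ψ eq₁ eq₂)
  value-∙ (ex φ) {ρ} {ρ₁} {ρ₂} eq₁ eq₂ = ⊆-antisym to from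
    where
    open FiniteJTrivialSemigroup (semigroup φ)
    open Power (semigroup φ) using (_⊙_; ∈⊙⁺; ∈⊙⁻)

    S₁ S₂ : Subset
    S₁ = value (ex φ) a ρ₁
    S₂ = value (ex φ) b ρ₂

    extend-reduce : ∀ k {n} {ρ : Zmod.Env c n} {ρ′ : Zmod.Env k n} {x x′} →
                    reduce k x ≡ x′ → (∀ i → reduce k (ρ i) ≡ ρ′ i) →
                    ∀ i → reduce k (Zmod.extend c x ρ i) ≡ Zmod.extend k x′ ρ′ i
    extend-reduce k p q zero    = p
    extend-reduce k p q (suc i) = q i

    value-extend : ∀ {x x₁ x₂} → reduce a x ≡ x₁ → reduce b x ≡ x₂ →
                   value φ c (Zmod.extend c x ρ) ≡
                   value φ a (Zmod.extend a x₁ ρ₁) ∙ value φ b (Zmod.extend b x₂ ρ₂)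
    value-extend p q = value-∙ φ (extend-reduce a p eq₁) (extend-reduce b q eq₂)

    to : ∀ {z} → z ∈ value (ex φ) c ρ → z ∈ S₁ ⊙ S₂
    to z∈ with x , refl ← Equivalence.to ∈⟦ isValue? φ c ρ ⟧ z∈ =
      subst (_∈ S₁ ⊙ S₂) (sym (value-extend refl refl))
        (∈⊙⁺ {S₁} {S₂} (Equivalence.from ∈⟦ isValue? φ a ρ₁ ⟧ (reduce a x , refl))
                       (Equivalence.from ∈⟦ isValue? φ b ρ₂ ⟧ (reduce b x , refl)))

    from : ∀ {z} → z ∈ S₁ ⊙ S₂ → z ∈ value (ex φ) c ρ
    from z∈ with _ , _ , u∈ , v∈ , refl ← ∈⊙⁻ {S₁} {S₂} z∈
            with x₁ , refl ← Equivalence.to ∈⟦ isValue? φ a ρ₁ ⟧ u∈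
            with x₂ , refl ← Equivalence.to ∈⟦ isValue? φ b ρ₂ ⟧ v∈
            -- Witnesses chosen independently in the two factors are glued into one.
            with x , p , q ← surjective x₁ x₂ =
      Equivalence.from ∈⟦ isValue? φ c ρ ⟧ (x , value-extend p q)

-- Each value is a multiple of the preceding one, so the sequence of values ascends for divisibility
-- and has two equal consecutive terms; `holds` then gives equal truth values.
indistinguishable : (σ : RingSentence) (P Q : ℕ → ℕ) → (∀ i → Splits (P (suc i)) (P i) (Q i)) →
                    ∃ λ i → P i ⊨R σ ≡ P (suc i) ⊨R σ
indistinguishable σ P Q split = i ,
  trans (sat-value σ (P i) _) (trans (cong (holds σ) (proj₂ stat)) (sym (sat-value σ (P (suc i)) _)))
  where
  open FiniteJTrivialSemigroup (semigroup σ)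

  w : ℕ → Carrier (semigroup σ)
  w i = value σ (P i) (Zmod.emptyEnv (P i))

  stat : ∃ λ i → w i ≡ w (suc i)
  stat = stationary ∣∙-trans ∣∙-antisym w
    (λ i → value σ (Q i) (Zmod.emptyEnv (Q i)) , value-∙ (split i) σ (λ ()) (λ ()))

  i : ℕ
  i = proj₁ stat

-- The sequence of moduli

module Moduli (f : ℕ) where

  -- The parameter f is d - 2, so the residue -1 is represented by `suc f`.
  d : ℕ
  d = suc (suc f)

  -- Moduli are represented by their predecessors: 1 + cofactor k = d (1+k) − 1
  -- and 1 + next k = (1+k) (d (1+k) − 1).
  cofactor next : ℕ → ℕ
  cofactor k = k + (k + f * suc k)
  next k = cofactor k + k * suc (cofactor k)

  P : ℕ → ℕ
  P zero    = 0
  P (suc i) = next (P i)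

  d*suc : ∀ k → d * suc k ≡ suc (suc (cofactor k))
  d*suc k = expand f k
    where
    expand : ∀ f k → suc (suc f) * suc k ≡ suc (suc (k + (k + f * suc k)))
    expand = solve-∀

  splits : ∀ i → Splits (P (suc i)) (P i) (cofactor (P i))
  splits i = ChineseRemainder.splits d (P i) (cofactor (P i)) (d*suc (P i))

  cofactor≡-1 : ∀ k → suc (cofactor k) % d ≡ suc f
  cofactor≡-1 k = %-pred-≡0 {suc (cofactor k)} {d}
    (trans (cong (_% d) (trans (sym (d*suc k)) (ℕ.*-comm d (suc k)))) (m*n%n≡0 (suc k) d))

  next-% : ∀ k → suc (next k) % d ≡ (suc k % d * suc f) % d
  -- `suc (next k)` computes to `suc k * suc (cofactor k)`.
  next-% k = trans (%-distribˡ-* (suc k) (suc (cofactor k)) d)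
                   (cong (λ t → (suc k % d * t) % d) (cofactor≡-1 k))

  1%d : 1 % d ≡ 1
  1%d = m<n⇒m%n≡m {n = d} (s≤s (s≤s z≤n))

  -1%d : suc f % d ≡ suc f
  -1%d = m<n⇒m%n≡m (ℕ.n<1+n (suc f))

  next-1 : ∀ k → suc k % d ≡ 1 → suc (next k) % d ≡ suc f
  next-1 k eq = trans (next-% k)
    (trans (cong (λ t → (t * suc f) % d) eq) (trans (cong (_% d) (ℕ.*-identityˡ (suc f))) -1%d))

  next--1 : ∀ k → suc k % d ≡ suc f → suc (next k) % d ≡ 1
  next--1 k eq = trans (next-% k)
    (trans (cong (λ t → (t * suc f) % d) eq)
      (trans (cong (_% d) (square f)) (trans ([m+kn]%n≡m%n 1 f d) 1%d)))
    where
    square : ∀ f → suc f * suc f ≡ 1 + f * suc (suc f)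
    square = solve-∀

  ±1 : ∀ i → suc (P i) % d ≡ 1 ⊎ suc (P i) % d ≡ suc f
  ±1 zero = inj₁ 1%d
  ±1 (suc i) with ±1 i
  ... | inj₁ eq = inj₂ (next-1 (P i) eq)
  ... | inj₂ eq = inj₁ (next--1 (P i) eq)

  -- Every element satisfies 0 = 0, so this counts the whole ring and says m ≡ 1 modulo d.
  size≡1 : RingModSentence d
  size≡1 = modEx (suc zero) (zer ≐ zer)

  ⊨size≡1 : ∀ k → ⊨M d k size≡1 ≡ does (suc k % d ℕ.≟ 1)
  ⊨size≡1 k = cong (λ c → does (c % d ℕ.≟ 1))
    (trans (count-true (allFin (suc k))) (length-tabulate {n = suc k} (λ i → i)))
    where
    count-true : ∀ xs → Zmod.countTrue k
                   (Zmod.mapL k (λ x → Zmod.sat k (modTest d) (Zmod.extend k x (Zmod.emptyEnv k)) (zer ≐ zer)) xs)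
                 ≡ length xs
    count-true []       = refl
    count-true (_ ∷ xs) = cong suc (count-true xs)

-- Comparison of the two logics

sat-embed : ∀ d k {n} (ρ : Zmod.Env k n) (φ : RingFormula n) →
            Zmod.sat k (modTest d) ρ (embed φ) ≡ Zmod.sat k noMod ρ φ
sat-embed d k ρ (s ≐ t)   = refl
sat-embed d k ρ (neg φ)   = cong not (sat-embed d k ρ φ)
sat-embed d k ρ (φ and ψ) = cong₂ _∧_ (sat-embed d k ρ φ) (sat-embed d k ρ ψ)
sat-embed d k ρ (ex φ)    =
  cong or (map-cong (λ x → sat-embed d k (Zmod.extend k x ρ) φ) (allFin (suc k)))

theorem5p12 : (d : ℕ) → d > 2 →
    ((σ : RingSentence) → (k : ℕ) → ⊨M d k (embed σ) ≡ k ⊨R σ)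
    × ∃ λ (θ : RingModSentence d) →
    (σ : RingSentence) → ¬ ((k : ℕ) → k ⊨R σ ≡ ⊨M d k θ)
theorem5p12 d@(suc (suc (suc f))) (s≤s (s≤s (s≤s _))) =
  (λ σ k → sat-embed d k (Zmod.emptyEnv k) σ) , size≡1 , inexpressible
  where
  -- Here d = f + 3, so the parameter d - 2 is `suc f` and -1 becomes `suc (suc f)`.
  open Moduli (suc f) hiding (d)

  test : ℕ → Bool
  test x = does (x ℕ.≟ 1)

  inexpressible : (σ : RingSentence) → ¬ ((k : ℕ) → k ⊨R σ ≡ ⊨M d k size≡1)
  inexpressible σ defines with i , same ← indistinguishable σ P (cofactor ∘ P) splits
    = contra (±1 i)
    where
    same-test : test (suc (P i) % d) ≡ test (suc (P (suc i)) % d)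
    same-test = trans (sym (trans (defines (P i)) (⊨size≡1 (P i))))
                  (trans same (trans (defines (P (suc i))) (⊨size≡1 (P (suc i)))))

    contra : ¬ (suc (P i) % d ≡ 1 ⊎ suc (P i) % d ≡ suc (suc f))
    -- One of the two consecutive residues is 1 and the other f + 2. The test accepts only the
    -- first, as f + 2 differs from 1; this is where d > 2 enters.
    contra (inj₁ eq) with () ← subst₂ (λ x y → test x ≡ test y) eq (next-1 (P i) eq) same-test
    contra (inj₂ eq) with () ← subst₂ (λ x y → test x ≡ test y) eq (next--1 (P i) eq) same-test
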